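{- Let $n\geq 0$ and $k\geq 3$ be integers. Then $f_k(n)=n$.
   Context: $\Sigma_k=\{0,1,\ldots,k-1\}$. A border of a word $w$ is a non-empty word that is both a proper prefix and a proper suffix of $w$; $w$ is unbordered if it has no border. A border $u$ of $w$ is non-overlapping if $|u|\le |w|/2$. The smallest BP-factorization of a word $w$ is the factorization $w=w_m\cdots w_1w_0w_1\cdots w_m$ ($m\ge 0$) in which, for each $i\ge 1$, $w_i$ is the longest non-overlapping border of $w_i\cdots w_1w_0w_1\cdots w_i$, and $w_0$ is either empty or unbordered (i.e., one repeatedly removes the longest non-overlapping border from both ends until an empty or unbordered central word remains). Its width is $2m+1$ if $w_0$ is non-empty and $2m$ if $w_0$ is empty. $f_k(n)$ denotes the maximum width of the smallest BP-factorization over all length-$n$ words over $\Sigma_k$. -}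

module Defs where

open import Data.Nat using (ℕ; zero; suc; _+_; _*_; _≤_; _<_; _≤?_; _<?_; s≤s)
open import Data.Nat.Properties
open import Data.Nat.Induction using (Acc; acc; <-wellFounded)
open import Data.Fin using (Fin)
import Data.Fin.Properties as Fin
open import Data.List using (List; []; _∷_; _++_; length; map; filter; inits; cartesianProductWith; allFin)
open import Data.List.Properties using (≡-dec; ∷-injective; length-++; length-++-≤ˡ; length-++-≤ʳ; ++-identityʳ; ++-cancelˡ; ++-cancelʳ)
open import Data.List.Extrema.Nat using (max; argmax; argmax-all; f[⊥]≤f[argmax]; f[xs]≤f[argmax])
open import Data.List.Membership.Propositional using (_∈_)
open import Data.List.Membership.Propositional.Properties using (∈-map⁺; ∈-filter⁺)
open import Data.List.Relation.Unary.All as All using (All; []; _∷_)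
open import Data.List.Relation.Unary.All.Properties using (all-filter)
open import Data.List.Relation.Unary.Any using (here; there)
open import Data.List.Relation.Binary.Pointwise as Pointwise using (Pointwise-≡⇒≡)
open import Data.List.Relation.Binary.Prefix.Heterogeneous using (Prefix; []; _∷_; _++ᵖ_)
open import Data.List.Relation.Binary.Prefix.Heterogeneous.Properties as Prefix using (prefix?)
open import Data.List.Relation.Binary.Suffix.Heterogeneous using (Suffix; here; there; _++ˢ_)
open import Data.List.Relation.Binary.Suffix.Heterogeneous.Properties as Suffix using (suffix?)
open import Data.Product using (∃; _×_; _,_; proj₁; proj₂)
open import Data.Sum using (_⊎_; inj₁; inj₂)
open import Relation.Binary using (DecidableEquality)
open import Relation.Binary.PropositionalEquality
open import Relation.Nullary using (¬_; Dec; yes; no; contradiction; ¬?)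
open import Relation.Nullary.Decidable using (map′; _×-dec_)

module _ {A : Set} where

  record Border (u w : List A) : Set where
    constructor border
    field
      nonEmpty : u ≢ []
      proper   : length u < length w
      prefix   : Prefix _≡_ u w
      suffix   : Suffix _≡_ u w

  Unbordered : List A → Set
  Unbordered w = ∀ u → ¬ Border u w

  -- |u| ≤ |w| / 2 is cleared of the division, so odd |w| needs no rounding.
  NonOverlappingBorder : List A → List A → Set
  NonOverlappingBorder u w = Border u w × 2 * length u ≤ length w

  LongestNonOverlappingBorder : List A → List A → Set
  LongestNonOverlappingBorder u w =
    NonOverlappingBorder u w × (∀ v → NonOverlappingBorder v w → length v ≤ length u)

-- w_m ⋯ w_1 w_0 w_1 ⋯ w_m is represented by  wings = w_m ∷ ⋯ ∷ w_1 ∷ []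
-- and  centre = w_0; the tails of  wings  give the factors w_i ⋯ w_0 ⋯ w_i.
record Factorization (A : Set) : Set where
  constructor factors
  field
    wings  : List (List A)
    centre : List A

module _ {A : Set} where

  unfactor : Factorization A → List A
  unfactor (factors []       c) = c
  unfactor (factors (u ∷ us) c) = u ++ unfactor (factors us c) ++ u

  IsSmallestBP : Factorization A → Set
  IsSmallestBP (factors []       c) = c ≡ [] ⊎ Unbordered c
  IsSmallestBP (factors (u ∷ us) c) =
    LongestNonOverlappingBorder u (unfactor (factors (u ∷ us) c)) × IsSmallestBP (factors us c)

  SmallestBPOf : List A → Factorization A → Set
  SmallestBPOf w F = unfactor F ≡ w × IsSmallestBP F

  width : Factorization A → ℕ
  width (factors us [])      = 2 * length us
  width (factors us (_ ∷ _)) = 2 * length us + 1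

module _ {A : Set} where

  private
    prefix⇒++ : ∀ {u w : List A} → Prefix _≡_ u w → ∃ λ x → u ++ x ≡ w
    prefix⇒++ {w = w} [] = w , refl
    prefix⇒++ (refl ∷ p) with x , eq ← prefix⇒++ p = x , cong (_ ∷_) eq

    ++⇒prefix : ∀ (u : List A) {x w} → u ++ x ≡ w → Prefix _≡_ u w
    ++⇒prefix u refl = Prefix.fromPointwise (Pointwise.refl refl) ++ᵖ _

    suffix⇒++ : ∀ {u w : List A} → Suffix _≡_ u w → ∃ λ y → y ++ u ≡ w
    suffix⇒++ (here eq) = [] , Pointwise-≡⇒≡ eq
    suffix⇒++ (there s) with y , eq ← suffix⇒++ s = _ ∷ y , cong (_ ∷_) eq

    ++⇒suffix : ∀ (y : List A) {u w} → y ++ u ≡ w → Suffix _≡_ u w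
    ++⇒suffix y refl = y ++ˢ here (Pointwise.refl refl)

    2*≡ : ∀ n → 2 * n ≡ n + n
    2*≡ n = cong (n +_) (+-identityʳ n)

    prefix⇒∈inits : ∀ {u w : List A} → Prefix _≡_ u w → u ∈ inits w
    prefix⇒∈inits []         = here refl
    prefix⇒∈inits (refl ∷ p) = there (∈-map⁺ (_ ∷_) (prefix⇒∈inits p))

    split : ∀ (as bs cs ds : List A) → as ++ bs ≡ cs ++ ds → length as ≤ length cs →
            ∃ λ es → as ++ es ≡ cs × es ++ ds ≡ bs
    split []       bs cs       ds eq _        = cs , refl , sym eq
    split (a ∷ as) bs (c ∷ cs) ds eq (s≤s le)
      with refl , eq′ ← ∷-injective eq
      with es , p , q ← split as bs cs ds eq′ le
      = es , cong (a ∷_) p , q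

  -- If two occurrences of a border overlap, then their overlap is a shorter border.
  shorten : ∀ {u w : List A} → Border u w → length w < 2 * length u →
            ∃ λ v → Border v w × length v < length u
  shorten {u} (border u≢[] u<w pre suf) over
    with y , refl ← suffix⇒++ suf | x , eq ← prefix⇒++ pre
    with ∣y∣<∣u∣ ← +-cancelʳ-< (length u) (length y) (length u)
                     (subst₂ _<_ (length-++ y) (2*≡ (length u)) over)
    with v , y++v≡u , v++x≡u ← split y u u x (sym eq) (<⇒≤ ∣y∣<∣u∣)
    = v , border v≢[] (<-trans v<u u<w)
            (Prefix.trans trans (++⇒prefix v v++x≡u) pre)
            (Suffix.trans trans (++⇒suffix y y++v≡u) suf)
        , v<u
    where
    0<∣y∣ : 0 < length y
    0<∣y∣ = +-cancelʳ-< (length u) 0 (length y) (subst (length u <_) (length-++ y) u<w)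
    v≢[] : v ≢ []
    v≢[] refl = <-irrefl (cong length (trans (sym (++-identityʳ y)) y++v≡u)) ∣y∣<∣u∣
    v<u : length v < length u
    v<u = subst (length v <_) (trans (sym (length-++ y)) (cong length y++v≡u))
            (m<n+m (length v) 0<∣y∣)

  nonOverlapping : ∀ {u w : List A} → Border u w → ∃ λ v → NonOverlappingBorder v w
  nonOverlapping b = go b (<-wellFounded _)
    where
    go : ∀ {u w} → Border u w → Acc _<_ (length u) → ∃ λ v → NonOverlappingBorder v w
    go {u} {w} b (acc rs) with 2 * length u ≤? length w
    ... | yes le = u , b , le
    ... | no ¬le with v , b′ , lt ← shorten b (≰⇒> ¬le) = go b′ (rs lt)

  peel : ∀ {u w : List A} → NonOverlappingBorder u w → ∃ λ v → u ++ v ++ u ≡ w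
  peel {u} (border _ _ pre suf , le)
    with x , refl ← prefix⇒++ pre | y , eq ← suffix⇒++ suf
    with v , _ , v++u≡x ← split u x y u (sym eq)
           (+-cancelʳ-≤ (length u) (length u) (length y)
             (subst₂ _≤_ (2*≡ (length u)) (trans (sym (cong length eq)) (length-++ y)) le))
    = v , cong (u ++_) v++u≡x

  peel-< : ∀ (u v : List A) → u ≢ [] → length v < length (u ++ v ++ u)
  peel-< []      v u≢[] = contradiction refl u≢[]
  peel-< (a ∷ u) v _    = s≤s (≤-trans (length-++-≤ˡ v) (length-++-≤ʳ (v ++ a ∷ u) {u}))

  module _ (_≟_ : DecidableEquality A) where

    border? : ∀ u w → Dec (Border u w)
    border? u w = map′
      (λ (a , b , c , d) → border a b c d) (λ (border a b c d) → a , b , c , d)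
      (¬? (≡-dec _≟_ u []) ×-dec length u <? length w
        ×-dec prefix? _≟_ u w ×-dec suffix? _≟_ u w)

    nonOverlappingBorder? : ∀ u w → Dec (NonOverlappingBorder u w)
    nonOverlappingBorder? u w = border? u w ×-dec 2 * length u ≤? length w

    longest : ∀ w → (∃ λ u → LongestNonOverlappingBorder u w) ⊎ Unbordered w
    longest w = select (filter P? (inits w)) (all-filter P? (inits w))
      λ v b → ∈-filter⁺ P? (prefix⇒∈inits (Border.prefix (proj₁ b))) b
      where
      P? : ∀ u → Dec (NonOverlappingBorder u w)
      P? u = nonOverlappingBorder? u w
      select : ∀ us → All (λ u → NonOverlappingBorder u w) us →
               (∀ v → NonOverlappingBorder v w → v ∈ us) →
               (∃ λ u → LongestNonOverlappingBorder u w) ⊎ Unbordered w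
      select [] _ complete = inj₂ none
        where
        none : Unbordered w
        none u b with v , b′ ← nonOverlapping b with () ← complete v b′
      select (u ∷ us) (b ∷ bs) complete =
        inj₁ (argmax length u us , argmax-all length b bs , maximal)
        where
        maximal : ∀ v → NonOverlappingBorder v w → length v ≤ length (argmax length u us)
        maximal v b′ with complete v b′
        ... | here refl = f[⊥]≤f[argmax] {f = length} u us
        ... | there v∈  = All.lookup (f[xs]≤f[argmax] {f = length} u us) v∈

    smallestBP : ∀ w → ∃ λ F → SmallestBPOf w F
    smallestBP w = go w (<-wellFounded (length w))
      where
      go : ∀ w → Acc _<_ (length w) → ∃ λ F → SmallestBPOf w F
      go w (acc rs) with longest w
      ... | inj₂ unb = factors [] w , refl , inj₂ unb
      ... | inj₁ (u , lb) with v , refl ← peel (proj₁ lb)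
          with factors us c , refl , s ← go v (rs (peel-< u v (Border.nonEmpty (proj₁ (proj₁ lb)))))
          = factors (u ∷ us) c , refl , lb , s

-- A smallest BP-factorization is unique, so the choice made by  smallestBP
-- does not affect widths.
module _ {A : Set} where

  private
    longest-unique : ∀ {u v w : List A} → LongestNonOverlappingBorder u w →
                     LongestNonOverlappingBorder v w → u ≡ v
    longest-unique (b , maxᵤ) (b′ , maxᵥ) =
      samePrefix (Border.prefix (proj₁ b)) (Border.prefix (proj₁ b′))
        (≤-antisym (maxᵥ _ b) (maxᵤ _ b′))
      where
      samePrefix : ∀ {u v w : List A} → Prefix _≡_ u w → Prefix _≡_ v w →
                   length u ≡ length v → u ≡ v
      samePrefix []         []         _ = refl
      samePrefix (refl ∷ p) (refl ∷ q) e = cong (_ ∷_) (samePrefix p q (suc-injective e))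

    centre-borderless : ∀ {c : List A} → c ≡ [] ⊎ Unbordered c → Unbordered c
    centre-borderless (inj₁ refl) u (border _ () _ _)
    centre-borderless (inj₂ unb)  = unb

  smallestBP-unique : ∀ {w : List A} (F G : Factorization A) →
                      SmallestBPOf w F → SmallestBPOf w G → F ≡ G
  smallestBP-unique (factors us c) (factors vs d) = go us vs
    where
    go : ∀ us vs {c d : List A} {w} → SmallestBPOf w (factors us c) →
         SmallestBPOf w (factors vs d) → factors us c ≡ factors vs d
    go [] [] (refl , _) (refl , _) = refl
    go [] (v ∷ vs) (refl , s) (eq , (b , _) , _) =
      contradiction (subst (Border v) eq (proj₁ b)) (centre-borderless s v)
    go (u ∷ us) [] (eq , (b , _) , _) (refl , s) =
      contradiction (subst (Border u) eq (proj₁ b)) (centre-borderless s u)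
    go (u ∷ us) (v ∷ vs) (refl , lb , s) (eq , lb′ , s′)
      with refl ← longest-unique lb (subst (LongestNonOverlappingBorder v) eq lb′)
      with refl ← go us vs (refl , s) (++-cancelʳ u _ _ (++-cancelˡ u _ _ eq) , s′)
      = refl

words : (k n : ℕ) → List (List (Fin k))
words k zero    = [] ∷ []
words k (suc n) = cartesianProductWith _∷_ (allFin k) (words k n)

smallestBPWidth : ∀ {k} → List (Fin k) → ℕ
smallestBPWidth w = width (proj₁ (smallestBP Fin._≟_ w))

-- The base value 0 changes no maximum over a non-empty list; words k n is empty
-- only when k = 0 and n > 0.
f : (k n : ℕ) → ℕ
f k n = max 0 (map smallestBPWidth (words k n))

{-# OPTIONS --safe #-}

-- A border of length at least 2 of a palindrome  v ++ c ++ reverse v  that fits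
-- inside v starts with two letters x y which are consecutive in v (read it as a
-- prefix) and also consecutive in reverse v (read it as a suffix).  If v cycles
-- through 0, 1, 2, then y = x + 1 and x = y + 1 modulo 3, which is absurd.  So only
-- single letters are peeled off, and the palindrome attains the trivial bound n.
module Submission where

open import Defs
open import Data.Nat using (ℕ; zero; suc; _+_; _*_; _≤_; _≥_; z≤n; s≤s; s≤s⁻¹)
open import Data.Nat.DivMod using (_/_; _%_; m%n<n; m≡m%n+[m/n]*n)
open import Data.Nat.Properties
open import Data.Nat.Tactic.RingSolver using (solve-∀)
open import Data.Fin using (Fin; zero; suc)
import Data.Fin.Properties as Fin
open import Data.List using (List; []; _∷_; [_]; _++_; length; map; reverse; _ʳ++_; replicate; iterate; allFin)
open import Data.List.Properties using (length-++; length-map; length-reverse; length-replicate; length-iterate; ++-assoc; unfold-reverse)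
open import Data.List.Extrema.Nat using (max≤v⁺; v≤max⁺)
open import Data.List.Membership.Propositional using (_∈_)
open import Data.List.Membership.Propositional.Properties using (∈-map⁺; ∈-allFin; ∈-cartesianProductWith⁺; ∈-cartesianProductWith⁻)
import Data.List.Relation.Unary.All as All
import Data.List.Relation.Unary.All.Properties as All
open import Data.List.Relation.Unary.Any as Any using (here)
open import Data.List.Relation.Unary.Linked as Linked using (Linked; []; [-]; _∷_)
open import Data.List.Relation.Binary.Pointwise as Pointwise using (Pointwise-≡⇒≡; Pointwise-length)
open import Data.List.Relation.Binary.Prefix.Heterogeneous using (Prefix; []; _∷_)
open import Data.List.Relation.Binary.Suffix.Heterogeneous using (Suffix; here; there; _++ˢ_)
open import Data.Product using (_,_; proj₂)
open import Data.Sum using (inj₁; inj₂)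
open import Function using (flip)
open import Level using (0ℓ)
open import Relation.Binary using (Rel; Asymmetric)
open import Relation.Binary.PropositionalEquality hiding ([_])
open import Relation.Nullary using (contradiction)

module _ {A : Set} where

  -- Every pair of wings adds exactly 2 to the width, and at least 2 letters to the word because a
  -- border is non-empty; a non-empty centre adds 1 to the width and at least one letter.
  width≤length : ∀ (F : Factorization A) → IsSmallestBP F → width F ≤ length (unfactor F)
  width≤length (factors [] [])           _ = z≤n
  width≤length (factors [] (_ ∷ _))      _ = s≤s z≤n
  width≤length (factors ([] ∷ us) c)     (((border u≢[] _ _ _ , _) , _) , _) =
    contradiction refl u≢[]
  width≤length (factors (u@(_ ∷ _) ∷ us) c) (_ , s) = begin
    width (factors (u ∷ us) c)          ≡⟨ width-∷ c ⟩
    2 + width (factors us c)            ≤⟨ +-monoʳ-≤ 2 (width≤length (factors us c) s) ⟩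
    -- The 2 is split into a 1 on each side of `length v`, one for each copy of `u`.
    2 + length v                        ≡⟨ cong suc (+-comm 1 (length v)) ⟩
    1 + (length v + 1)                  ≤⟨ +-mono-≤ {1} {length u} (s≤s z≤n) (+-monoʳ-≤ (length v) (s≤s z≤n)) ⟩
    length u + (length v + length u)    ≡⟨ cong (length u +_) (length-++ v) ⟨
    length u + length (v ++ u)          ≡⟨ length-++ u ⟨
    length (u ++ v ++ u)                ∎
    where
    open ≤-Reasoning
    v = unfactor (factors us c)
    width-∷ : ∀ c → width (factors (u ∷ us) c) ≡ 2 + width (factors us c)
    width-∷ []      = *-suc 2 (length us)
    width-∷ (_ ∷ _) = cong (_+ 1) (*-suc 2 (length us))

  -- The accumulator form of `Linked-reverse`: the letter `x` heads both lists, so the link across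
  -- the seam is available, reversed, at each step.
  Linked-ʳ++ : ∀ {R : Rel A 0ℓ} {x xs ys} → Linked R (x ∷ xs) → Linked (flip R) (x ∷ ys) →
               Linked (flip R) (xs ʳ++ (x ∷ ys))
  Linked-ʳ++ [-]      ls = ls
  Linked-ʳ++ (r ∷ rs) ls = Linked-ʳ++ rs (r ∷ ls)

  Linked-reverse : ∀ {R : Rel A 0ℓ} {xs} → Linked R xs → Linked (flip R) (reverse xs)
  Linked-reverse []         = []
  Linked-reverse [-]        = [-]
  Linked-reverse l@(_ ∷ _)  = Linked-ʳ++ l [-]

  Linked-suffix : ∀ {R : Rel A 0ℓ} {us ws} → Suffix _≡_ us ws → Linked R ws → Linked R us
  Linked-suffix (here eq) l with refl ← Pointwise-≡⇒≡ eq = l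
  Linked-suffix (there s) l = Linked-suffix s (Linked.tail l)

  suffix-++ʳ : ∀ {us} xs {ys : List A} → length us ≤ length ys →
               Suffix _≡_ us (xs ++ ys) → Suffix _≡_ us ys
  suffix-++ʳ []       _  s         = s
  suffix-++ʳ (_ ∷ xs) le (there s) = suffix-++ʳ xs le s
  -- Here `us` would be the whole of `x ∷ xs ++ ys`, which is longer than `ys`.
  suffix-++ʳ {us} (x ∷ xs) {ys} le (here eq) = contradiction le (<⇒≱ (begin-strict
    length ys               ≤⟨ m≤n+m (length ys) (length xs) ⟩
    length xs + length ys   <⟨ n<1+n _ ⟩
    suc (length xs + length ys) ≡⟨ cong suc (length-++ xs) ⟨
    length (x ∷ xs ++ ys)   ≡⟨ Pointwise-length eq ⟨
    length us               ∎))
    where open ≤-Reasoning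

  singletonWings : List A → List A → Factorization A
  singletonWings v c = factors (map [_] v) c

  unfactor-singletonWings : ∀ v c → unfactor (singletonWings v c) ≡ v ++ c ++ reverse v
  unfactor-singletonWings []      []      = refl
  unfactor-singletonWings []      (x ∷ c) = cong (x ∷_) (unfactor-singletonWings [] c)
  unfactor-singletonWings (a ∷ v) c       = cong (a ∷_) (begin
    unfactor (singletonWings v c) ++ [ a ]   ≡⟨ cong (_++ [ a ]) (unfactor-singletonWings v c) ⟩
    (v ++ c ++ reverse v) ++ [ a ]           ≡⟨ ++-assoc v (c ++ reverse v) [ a ] ⟩
    v ++ (c ++ reverse v) ++ [ a ]           ≡⟨ cong (v ++_) (++-assoc c (reverse v) [ a ]) ⟩
    v ++ c ++ reverse v ++ [ a ]             ≡⟨ cong (λ r → v ++ c ++ r) (unfold-reverse a v) ⟨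
    v ++ c ++ reverse (a ∷ v)                ∎)
    where open ≡-Reasoning

  length-unfactor-singletonWings : ∀ v c →
    length (unfactor (singletonWings v c)) ≡ length c + length v * 2
  length-unfactor-singletonWings v c = begin
    length (unfactor (singletonWings v c))   ≡⟨ cong length (unfactor-singletonWings v c) ⟩
    length (v ++ c ++ reverse v)             ≡⟨ length-++ v ⟩
    length v + length (c ++ reverse v)       ≡⟨ cong (length v +_) (length-++ c) ⟩
    length v + (length c + length (reverse v)) ≡⟨ cong (λ m → length v + (length c + m)) (length-reverse v) ⟩
    length v + (length c + length v)         ≡⟨ shuffle (length v) (length c) ⟩
    length c + length v * 2                  ∎
    where
    open ≡-Reasoning
    shuffle : ∀ m l → m + (l + m) ≡ l + m * 2
    shuffle = solve-∀

  -- The right-hand side is also the length of the word. A non-empty centre counts once in the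
  -- width, so the two agree when `c` has at most one letter.
  width-singletonWings : ∀ v {c} → length c ≤ 1 → width (singletonWings v c) ≡ length c + length v * 2
  width-singletonWings v {[]}    _        = trans (cong (2 *_) (length-map [_] v)) (*-comm 2 (length v))
  width-singletonWings v {_ ∷ []} _       = begin
    2 * length (map [_] v) + 1   ≡⟨ +-comm _ 1 ⟩
    1 + 2 * length (map [_] v)   ≡⟨ cong (λ m → 1 + 2 * m) (length-map [_] v) ⟩
    1 + 2 * length v             ≡⟨ cong suc (*-comm 2 (length v)) ⟩
    1 + length v * 2             ∎
    where open ≡-Reasoning
  width-singletonWings v {_ ∷ _ ∷ _} (s≤s ())

  length≤1⇒unbordered : ∀ {c : List A} → length c ≤ 1 → Unbordered c
  length≤1⇒unbordered le []      (border u≢[] _ _ _) = u≢[] refl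
  length≤1⇒unbordered le (_ ∷ _) (border _ u<c _ _)  with () ← s≤s⁻¹ (≤-trans u<c le)

  module _ {R : Rel A 0ℓ} (asym : Asymmetric R) {c : List A} (∣c∣≤1 : length c ≤ 1) where

    nonOverlapping-length≤1 : ∀ {v} → Linked R v → ∀ u →
      NonOverlappingBorder u (unfactor (singletonWings v c)) → length u ≤ 1
    nonOverlapping-length≤1     _ []          _ = z≤n
    nonOverlapping-length≤1     _ (_ ∷ [])    _ = s≤s z≤n
    nonOverlapping-length≤1 {v} l u@(x ∷ y ∷ _) (border _ _ pre suf , 2∣u∣≤∣w∣) =
      conflict l ∣u∣≤∣v∣ pre
      where
      ∣u∣≤∣v∣ : length u ≤ length v
      -- The possible centre letter is absorbed by a strict bound: twice the length of `u` is below
      -- twice `suc (length v)`.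
      ∣u∣≤∣v∣ = s≤s⁻¹ (*-cancelʳ-< 2 (length u) (suc (length v)) (begin-strict
        length u * 2               ≡⟨ *-comm (length u) 2 ⟩
        2 * length u               ≤⟨ 2∣u∣≤∣w∣ ⟩
        length (unfactor (singletonWings v c)) ≡⟨ length-unfactor-singletonWings v c ⟩
        length c + length v * 2    <⟨ +-monoˡ-< (length v * 2) (s≤s ∣c∣≤1) ⟩
        suc (length v) * 2         ∎))
        where open ≤-Reasoning
      suffix-reverse : Suffix _≡_ u (reverse v)
      -- Grouping `c` with the left half leaves exactly `reverse v` as the tail, which is long
      -- enough to contain `u`.
      suffix-reverse = suffix-++ʳ (v ++ c)
        (subst (length u ≤_) (sym (length-reverse v)) ∣u∣≤∣v∣)
        (subst (Suffix _≡_ u)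
          (trans (unfactor-singletonWings v c) (sym (++-assoc v c (reverse v)))) suf)
      Ryx : R y x
      Ryx = Linked.head (Linked-suffix suffix-reverse (Linked-reverse l))
      -- Quantified over `v` afresh, so that matching on the links exposes its first two letters;
      -- these also begin the palindrome and hence are `x` and `y`.
      conflict : ∀ {v} → Linked R v → length u ≤ length v →
                 Prefix _≡_ u (unfactor (singletonWings v c)) → length u ≤ 1
      conflict []        () _
      conflict [-]       (s≤s ()) _
      conflict (Rxy ∷ _) _ (refl ∷ refl ∷ _) = contradiction Ryx (asym Rxy)

    -- Induction on `v`: the outer letter is a border of the maximal length 1, and removing both
    -- copies leaves the same kind of palindrome over the tail of `v`.
    singletonWings-isSmallestBP : ∀ {v} → Linked R v → IsSmallestBP (singletonWings v c)
    singletonWings-isSmallestBP {[]}    _ = inj₂ (length≤1⇒unbordered ∣c∣≤1)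
    singletonWings-isSmallestBP {a ∷ v} l =
      ((border (λ ()) 2≤ (refl ∷ []) ((a ∷ w) ++ˢ here (Pointwise.refl refl)) , 2≤)
        , nonOverlapping-length≤1 l)
      , singletonWings-isSmallestBP (Linked.tail l)
      where
      w = unfactor (singletonWings v c)
      -- Serves twice: as properness of the one-letter border and as its non-overlap condition.
      2≤ : 2 ≤ length (a ∷ w ++ [ a ])
      2≤ = s≤s (subst (1 ≤_) (sym (length-++ w)) (m≤n+m 1 (length w)))

  iterate-linked : ∀ (g : A → A) x n → Linked (λ y z → z ≡ g y) (iterate g x n)
  iterate-linked g x 0             = []
  iterate-linked g x 1             = [-]
  iterate-linked g x (suc (suc n)) = refl ∷ iterate-linked g (g x) (suc n)

words-length : ∀ k n {w} → w ∈ words k n → length w ≡ n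
words-length k zero    (here refl) = refl
words-length k (suc n) w∈
  with _ , _ , _ , w′∈ , refl ← ∈-cartesianProductWith⁻ _∷_ (allFin k) (words k n) w∈
  = cong suc (words-length k n w′∈)

words-complete : ∀ {k} (w : List (Fin k)) → w ∈ words k (length w)
words-complete []      = here refl
words-complete (a ∷ w) = ∈-cartesianProductWith⁺ _∷_ (∈-allFin a) (words-complete w)

smallestBPWidth≤length : ∀ {k} (w : List (Fin k)) → smallestBPWidth w ≤ length w
smallestBPWidth≤length w with F , refl , s ← smallestBP Fin._≟_ w = width≤length F s

-- By uniqueness, a factorization exhibited by hand is the one that `smallestBP` computes, so the
-- search need not be evaluated.
smallestBPWidth-unfactor : ∀ {k} (F : Factorization (Fin k)) → IsSmallestBP F →
                           smallestBPWidth (unfactor F) ≡ width F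
smallestBPWidth-unfactor F s =
  cong width (smallestBP-unique _ F (proj₂ (smallestBP Fin._≟_ (unfactor F))) (refl , s))

f≤n : ∀ k n → f k n ≤ n
-- `z≤n` bounds the base value 0 of the maximum.
f≤n k n = max≤v⁺ z≤n (All.map⁺ (All.tabulate λ {w} w∈ →
  subst (smallestBPWidth w ≤_) (words-length k n w∈) (smallestBPWidth≤length w)))

smallestBPWidth≤f : ∀ {k} (w : List (Fin k)) → smallestBPWidth w ≤ f k (length w)
smallestBPWidth≤f w = v≤max⁺ 0 _
  (inj₂ (Any.map ≤-reflexive (∈-map⁺ smallestBPWidth (words-complete w))))

-- The 3-cycle on 0, 1, 2, with all further letters sent to 0. Three is the least cycle length whose
-- successor relation is asymmetric, and this is where `k ≥ 3` enters.
next : ∀ {j} → Fin (3 + j) → Fin (3 + j)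
next zero          = suc zero
next (suc zero)    = suc (suc zero)
next (suc (suc _)) = zero

next-asym : ∀ {j} → Asymmetric (λ (x y : Fin (3 + j)) → y ≡ next x)
-- `refl` replaces `y` by `next x`; what remains, `x ≡ next (next x)`, fails for each letter.
next-asym {x = zero}           refl ()
next-asym {x = suc zero}       refl ()
next-asym {x = suc (suc zero)} refl ()
next-asym {x = suc (suc (suc _))} refl ()

theorem7 : (n k : ℕ) → k ≥ 3 → f k n ≡ n
theorem7 n k@(suc (suc (suc j))) (s≤s (s≤s (s≤s z≤n))) = ≤-antisym (f≤n k n) (begin
  n                                ≡⟨ size ⟨
  length c + length v * 2          ≡⟨ width-singletonWings v {c} ∣c∣≤1 ⟨
  width F                          ≡⟨ smallestBPWidth-unfactor F isSmallest ⟨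
  smallestBPWidth (unfactor F)     ≤⟨ smallestBPWidth≤f (unfactor F) ⟩
  f k (length (unfactor F))        ≡⟨ cong (f k) (length-unfactor-singletonWings v c) ⟩
  f k (length c + length v * 2)    ≡⟨ cong (f k) size ⟩
  f k n                            ∎)
  where
  open ≤-Reasoning
  v c : List (Fin k)
  -- Halving `n` fixes the shape: `n / 2` letters on each side, and the parity of `n` decides
  -- whether the centre is empty or one letter.
  v = iterate next zero (n / 2)
  c = replicate (n % 2) zero
  F = singletonWings v c
  ∣c∣≤1 : length c ≤ 1
  ∣c∣≤1 = subst (_≤ 1) (sym (length-replicate (n % 2))) (s≤s⁻¹ (m%n<n n 2))
  isSmallest : IsSmallestBP F
  isSmallest = singletonWings-isSmallestBP next-asym ∣c∣≤1 (iterate-linked next zero (n / 2))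
  size : length c + length v * 2 ≡ n
  size = trans
    (cong₂ (λ r q → r + q * 2) (length-replicate (n % 2)) (length-iterate next zero (n / 2)))
    (sym (m≡m%n+[m/n]*n n 2))
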